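{- Let $G$ be a connected graph of order $n$, minimum degree $\delta \geq 2$ and power domination number $\gamma_p = \gamma_p(G) \geq 2$. Then \[ rad_p(G) \leq \begin{cases} n - 5 & \text{if } \gamma_p = 2 \text{ and } \delta = 2,\\ n - \delta - 2 & \text{if } \gamma_p = 2 \text{ and } \delta > 2,\\ n - \gamma_p - \max\{2\gamma_p,\ \gamma_p + \delta\} + 1 & \text{if } \gamma_p > 2. \end{cases} \]
   Context: All graphs are finite, simple, undirected and non-empty. For a graph $G$ and $S \subseteq V(G)$, define $P^1_G(S) = N[S]$ (the closed neighbourhood of $S$), and for $i \geq 1$ let $V^i = \{v \in P^i_G(S) : |N[v] \setminus P^i_G(S)| \leq 1\}$ and $P^{i+1}_G(S) = P^i_G(S) \cup N[V^i]$. The set $S$ is a power dominating set (PDS) of $G$ if $P^i_G(S) = V(G)$ for some $i \ge 1$. The power domination number $\gamma_p(G)$ is the minimum cardinality of a PDS of $G$. For a PDS $S$, $rad_p(G,S) = \min\{i \geq 1 : P^i_G(S) = V(G)\}$. The propagation radius of $G$ is $rad_p(G) = \min\{rad_p(G,S) : S \text{ is a PDS of } G \text{ with } |S| = \gamma_p(G)\}$. -}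

module Defs where

open import Data.Fin.Base using (Fin)
open import Data.Fin.Properties using (any?)
open import Data.Fin.Subset using (Subset; _∈_; _∪_; _─_; ⁅_⁆; ⊤; ∣_∣)
open import Data.Fin.Subset.Properties using (_∈?_)
open import Data.Nat.Base using (ℕ; zero; suc; _≤_; NonZero)
open import Data.Nat.Properties using (_≤?_)
open import Data.Product.Base using (∃; _×_)
open import Data.Vec.Base using (tabulate)
open import Level using (0ℓ)
open import Relation.Binary.Construct.Closure.ReflexiveTransitive using (Star)
open import Relation.Binary.Core using (Rel)
import Relation.Binary.Definitions as B
open import Relation.Binary.PropositionalEquality.Core using (_≡_)
open import Relation.Nullary.Decidable.Core using (does; _×-dec_)
open import Relation.Unary using (Pred; Decidable)

IsMinimum : Pred ℕ 0ℓ → Pred ℕ 0ℓ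
IsMinimum A m = A m × (∀ k → A k → m ≤ k)

record Graph (n : ℕ) : Set₁ where
  field
    nonEmpty : NonZero n
    Adj      : Rel (Fin n) 0ℓ
    adj?     : B.Decidable Adj
    sym      : B.Symmetric Adj
    irrefl   : B.Irreflexive _≡_ Adj

⟪_⟫ : ∀ {n} {A : Pred (Fin n) 0ℓ} → Decidable A → Subset n
⟪ A? ⟫ = tabulate (λ v → does (A? v))

module _ {n : ℕ} (G : Graph n) where
  open Graph G

  Connected : Set
  Connected = ∀ u v → Star Adj u v

  openNbhd : Fin n → Subset n
  openNbhd v = ⟪ adj? v ⟫

  degree : Fin n → ℕ
  degree v = ∣ openNbhd v ∣

  IsMinDegree : Pred ℕ 0ℓ
  IsMinDegree = IsMinimum (λ d → ∃ λ v → degree v ≡ d)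

  N[_] : Fin n → Subset n
  N[ v ] = ⁅ v ⁆ ∪ openNbhd v

  N⟦_⟧ : Subset n → Subset n
  N⟦ S ⟧ = ⟪ (λ u → any? (λ v → (v ∈? S) ×-dec (u ∈? N[ v ]))) ⟫

  -- The vertices of X with at most one closed neighbour outside X; the set Vⁱ
  -- of the propagation rule is  propagators (P S i).
  propagators : Subset n → Subset n
  propagators X = ⟪ (λ v → (v ∈? X) ×-dec (∣ N[ v ] ─ X ∣ ≤? 1)) ⟫

  -- Pⁱ(S) is only defined for i ≥ 1; the value at 0 is a dummy, and every use
  -- below requires 1 ≤ i.
  P : Subset n → ℕ → Subset n
  P S zero          = S
  P S (suc zero)    = N⟦ S ⟧
  P S (suc (suc i)) = P S (suc i) ∪ N⟦ propagators (P S (suc i)) ⟧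

  CoversAt : Subset n → Pred ℕ 0ℓ
  CoversAt S i = 1 ≤ i × P S i ≡ ⊤

  IsPDS : Pred (Subset n) 0ℓ
  IsPDS S = ∃ (CoversAt S)

  -- Numerical invariants are given as relations: "IsX G k" says that the
  -- (unique) value of the invariant is k.
  IsPowerDominationNumber : Pred ℕ 0ℓ
  IsPowerDominationNumber = IsMinimum (λ k → ∃ λ S → IsPDS S × ∣ S ∣ ≡ k)

  IsRadius : Subset n → Pred ℕ 0ℓ
  IsRadius S = IsMinimum (CoversAt S)

  IsPropagationRadius : Pred ℕ 0ℓ
  IsPropagationRadius = IsMinimum
    (λ r → ∃ λ S → IsPDS S × IsPowerDominationNumber ∣ S ∣ × IsRadius S r)

{-# OPTIONS --safe #-}

-- Each propagation step adds a vertex, so rad_p(G,S) ≤ n + 1 - |N[S]| for every power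
-- dominating set S; it remains to find a minimum one with |N[S]| large.  A minimum
-- PDS S with fewest isolated vertices in G[S] gives every v ∈ S two external private
-- neighbours.  Counting these besides S, or besides N[w] for one w ∈ S, yields
-- |N[S]| ≥ 3γ and |N[S]| ≥ 2γ + δ - 1.  Suppose γ > 2 and the second bound is attained,
-- and let a be a private neighbour of v ∈ S.  If a has two neighbours outside N[S],
-- then S - v + a is a minimum PDS with a larger closed neighbourhood.  Otherwise a is
-- adjacent to a private neighbour of some u ≠ v in S, and S - u - v + a is a PDS
-- smaller than the minimum.
module Submission where

open import Defs
open import Data.Nat using (ℕ; _+_; _*_; _⊔_; _≥_; _>_)
open import Data.Integer as ℤ using (+_)
open import Data.Product using (_×_)
open import Relation.Binary.PropositionalEquality using (_≡_)
import Data.Bool.Properties as Bool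
open import Data.Fin.Base using (Fin; zero; suc)
open import Data.Fin.Properties using (any?; _≟_; suc-injective)
open import Data.Fin.Subset
  using (Subset; inside; outside; _∈_; _∉_; _⊆_; _∪_; _∩_; _─_; _-_; ⁅_⁆; ⊤; ∣_∣)
open import Data.Fin.Subset.Properties
import Data.Integer.Properties as ℤ
open import Data.Integer.Tactic.RingSolver using () renaming (solve-∀ to ℤ-solve-∀)
open import Data.Nat.Base using (suc; zero; _≤_; _<_; _∸_; z≤n; s≤s; s≤s⁻¹)
open import Data.Nat.Induction using (Acc; acc; <-wellFounded)
open import Data.Nat.Properties hiding (_≟_; suc-injective)
open import Data.Nat.Tactic.RingSolver using (solve-∀)
open import Data.Product using (∃; _,_; proj₁; proj₂)
open import Data.Sum using (_⊎_; inj₁; inj₂)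
open import Data.Vec.Base using (_∷_; []; here; there)
import Data.Vec.Properties as Vec
open import Function using (_∘_; id)
open import Level using (0ℓ)
open import Relation.Binary.PropositionalEquality using (_≢_; refl; sym; trans; cong; cong₂; subst)
open import Relation.Nullary using (yes; no; contradiction; does; ¬?)
open import Relation.Nullary.Decidable using (_×-dec_; dec-true; decidable-stable)
open import Relation.Unary using (Pred; Decidable)

private
  variable
    k m n : ℕ
    x : Fin n
    p q r : Subset n

-- Least witnesses of decidable predicates

least : {A : Pred ℕ 0ℓ} → Decidable A → A m → ∃ λ k → IsMinimum A k × k ≤ m
least {zero}  A? a = 0 , (a , λ _ _ → z≤n) , z≤n
least {suc m} {A} A? a with A? 0
... | yes a₀ = 0 , (a₀ , λ _ _ → z≤n) , z≤n
... | no ¬a₀ with least (A? ∘ suc) a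
...   | k , (aₖ , min) , k≤m = suc k , (aₖ , min′) , s≤s k≤m
  where
  min′ : ∀ j → A j → suc k ≤ j
  min′ zero    a₀ = contradiction a₀ ¬a₀
  min′ (suc j) aⱼ = s≤s (min j aⱼ)

-- Finite sets

∈⟪⟫⁺ : {A : Pred (Fin n) 0ℓ} (A? : Decidable A) → A x → x ∈ ⟪ A? ⟫
∈⟪⟫⁺ {x = x} A? a =
  Vec.lookup⇒[]= x _ (trans (Vec.lookup∘tabulate _ x) (dec-true (A? x) a))

∈⟪⟫⁻ : {A : Pred (Fin n) 0ℓ} (A? : Decidable A) → x ∈ ⟪ A? ⟫ → A x
∈⟪⟫⁻ {x = x} A? x∈ with A? x | trans (sym (Vec.lookup∘tabulate (does ∘ A?) x)) (Vec.[]=⇒lookup x∈)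
... | yes a | _ = a
... | no _  | ()

x∈p─q⇒x∉q : ∀ (p q : Subset n) → x ∈ p ─ q → x ∉ q
x∈p─q⇒x∉q (_ ∷ p) (inside  ∷ q) (there x∈p─q) (there x∈q) = x∈p─q⇒x∉q p q x∈p─q x∈q
x∈p─q⇒x∉q (_ ∷ p) (outside ∷ q) (there x∈p─q) (there x∈q) = x∈p─q⇒x∉q p q x∈p─q x∈q

x∈p-y⁻ : ∀ (p : Subset n) y → x ∈ p - y → x ∈ p × x ≢ y
x∈p-y⁻ p y x∈ = p─q⊆p p ⁅ y ⁆ x∈ , λ { refl → x∈p─q⇒x∉q p ⁅ y ⁆ x∈ (x∈⁅x⁆ y) }

∣p∪q∣≤∣p∣+∣q∣ : ∀ (p q : Subset n) → ∣ p ∪ q ∣ ≤ ∣ p ∣ + ∣ q ∣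
∣p∪q∣≤∣p∣+∣q∣ []            []            = z≤n
∣p∪q∣≤∣p∣+∣q∣ (inside  ∷ p) (outside ∷ q) = s≤s (∣p∪q∣≤∣p∣+∣q∣ p q)
∣p∪q∣≤∣p∣+∣q∣ (outside ∷ p) (outside ∷ q) = ∣p∪q∣≤∣p∣+∣q∣ p q
∣p∪q∣≤∣p∣+∣q∣ (outside ∷ p) (inside  ∷ q) =
  subst (suc ∣ p ∪ q ∣ ≤_) (sym (+-suc ∣ p ∣ ∣ q ∣)) (s≤s (∣p∪q∣≤∣p∣+∣q∣ p q))
∣p∪q∣≤∣p∣+∣q∣ (inside  ∷ p) (inside  ∷ q) =
  s≤s (≤-trans (∣p∪q∣≤∣p∣+∣q∣ p q) (+-monoʳ-≤ ∣ p ∣ (n≤1+n ∣ q ∣)))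

p⊆q∪r⇒∣p∣≤∣q∣+∣r∣ : p ⊆ q ∪ r → ∣ p ∣ ≤ ∣ q ∣ + ∣ r ∣
p⊆q∪r⇒∣p∣≤∣q∣+∣r∣ {q = q} {r} p⊆q∪r = ≤-trans (p⊆q⇒∣p∣≤∣q∣ p⊆q∪r) (∣p∪q∣≤∣p∣+∣q∣ q r)

∣p∣≤∣p-x∣+1 : ∀ (p : Subset n) x → ∣ p ∣ ≤ ∣ p - x ∣ + 1
∣p∣≤∣p-x∣+1 p x = subst (λ c → ∣ p ∣ ≤ ∣ p - x ∣ + c) (∣⁅x⁆∣≡1 x)
  (p⊆q∪r⇒∣p∣≤∣q∣+∣r∣ p⊆)
  where
  p⊆ : p ⊆ (p - x) ∪ ⁅ x ⁆
  p⊆ {y} y∈p with y ≟ x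
  ... | yes refl = x∈p∪q⁺ (inj₂ (x∈⁅x⁆ y))
  ... | no  y≢x  = x∈p∪q⁺ (inj₁ (x∈p∧x≢y⇒x∈p-y y∈p y≢x))

disjoint⇒∣p∣+∣q∣≤∣r∣ : p ⊆ r → q ⊆ r → (∀ {x} → x ∈ p → x ∉ q) → ∣ p ∣ + ∣ q ∣ ≤ ∣ r ∣
disjoint⇒∣p∣+∣q∣≤∣r∣ {p = []} {[]} {[]} _ _ _ = z≤n
disjoint⇒∣p∣+∣q∣≤∣r∣ {p = inside ∷ p} {_} {inside ∷ q} _ _ dis = contradiction here (dis here)
disjoint⇒∣p∣+∣q∣≤∣r∣ {p = inside ∷ p} {c ∷ r} {outside ∷ q} p⊆r q⊆r dis with p⊆r here
... | here = s≤s (disjoint⇒∣p∣+∣q∣≤∣r∣ (drop-∷-⊆ p⊆r) (drop-∷-⊆ q⊆r) (λ x∈p x∈q → dis (there x∈p) (there x∈q)))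
disjoint⇒∣p∣+∣q∣≤∣r∣ {p = outside ∷ p} {c ∷ r} {inside ∷ q} p⊆r q⊆r dis with q⊆r here
... | here = subst (_≤ suc ∣ r ∣) (sym (+-suc ∣ p ∣ ∣ q ∣))
  (s≤s (disjoint⇒∣p∣+∣q∣≤∣r∣ (drop-∷-⊆ p⊆r) (drop-∷-⊆ q⊆r) (λ x∈p x∈q → dis (there x∈p) (there x∈q))))
disjoint⇒∣p∣+∣q∣≤∣r∣ {p = outside ∷ p} {c ∷ r} {outside ∷ q} p⊆r q⊆r dis =
  ≤-trans (disjoint⇒∣p∣+∣q∣≤∣r∣ (drop-∷-⊆ p⊆r) (drop-∷-⊆ q⊆r) (λ x∈p x∈q → dis (there x∈p) (there x∈q)))
    (∣p∣≤∣x∷p∣ c r)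

q⊆p⇒∣p─q∣+∣q∣≤∣p∣ : q ⊆ p → ∣ p ─ q ∣ + ∣ q ∣ ≤ ∣ p ∣
q⊆p⇒∣p─q∣+∣q∣≤∣p∣ {q = q} {p} q⊆p = disjoint⇒∣p∣+∣q∣≤∣r∣ (p─q⊆p p q) q⊆p (x∈p─q⇒x∉q p q)

∣q∣<∣p∣⇒∃∈p∉q : ∀ (p q : Subset n) → ∣ q ∣ < ∣ p ∣ → ∃ λ x → x ∈ p × x ∉ q
∣q∣<∣p∣⇒∃∈p∉q p q ∣q∣<∣p∣ with any? (λ x → (x ∈? p) ×-dec ¬? (x ∈? q))
... | yes found = found
... | no  none  = contradiction ∣q∣<∣p∣ (≤⇒≯ (p⊆q⇒∣p∣≤∣q∣ λ {x} x∈p →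
  decidable-stable (x ∈? q) (λ x∉q → none (x , x∈p , x∉q))))

0<∣p∣⇒∃∈p : ∀ (p : Subset n) → 0 < ∣ p ∣ → ∃ (_∈ p)
0<∣p∣⇒∃∈p {n} p 0<∣p∣
  with x , x∈p , _ ← ∣q∣<∣p∣⇒∃∈p∉q p (p ─ ⊤) (subst (_< ∣ p ∣) (sym (trans (cong ∣_∣ (p─⊤≡⊥ p)) (∣⊥∣≡0 n))) 0<∣p∣)
  = x , x∈p

-- Induction along `S`: disjointness keeps the later blocks inside `X` once the first block has been
-- cut out. It is applied to blocks of private neighbours.
packing : ∀ (S : Subset m) (Q : Fin m → Subset n) (X : Subset n) →
  (∀ {u} → u ∈ S → k ≤ ∣ Q u ∣) →
  (∀ {u} → u ∈ S → Q u ⊆ X) →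
  (∀ {u v x} → u ∈ S → v ∈ S → x ∈ Q u → x ∈ Q v → u ≡ v) →
  ∣ S ∣ * k ≤ ∣ X ∣
packing []            Q X large Q⊆X dis = z≤n
packing (outside ∷ S) Q X large Q⊆X dis =
  packing S (Q ∘ suc) X (large ∘ there) (Q⊆X ∘ there) (λ u∈ v∈ xu xv → suc-injective (dis (there u∈) (there v∈) xu xv))
packing {k = k} (inside ∷ S) Q X large Q⊆X dis = begin
  k + ∣ S ∣ * k              ≤⟨ +-mono-≤ (large here) rest ⟩
  ∣ Q zero ∣ + ∣ X ─ Q zero ∣ ≡⟨ +-comm ∣ Q zero ∣ _ ⟩
  ∣ X ─ Q zero ∣ + ∣ Q zero ∣ ≤⟨ q⊆p⇒∣p─q∣+∣q∣≤∣p∣ (Q⊆X here) ⟩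
  ∣ X ∣                      ∎
  where
  open ≤-Reasoning
  rest : ∣ S ∣ * k ≤ ∣ X ─ Q zero ∣
  rest = packing S (Q ∘ suc) (X ─ Q zero) (large ∘ there)
    (λ u∈S x∈Qu → x∈p∧x∉q⇒x∈p─q (Q⊆X (there u∈S) x∈Qu)
      (λ x∈Q₀ → contradiction (dis (there u∈S) here x∈Qu x∈Q₀) λ ()))
    (λ u∈ v∈ xu xv → suc-injective (dis (there u∈) (there v∈) xu xv))

exchange : Subset n → Fin n → Fin n → Subset n
exchange S v a = ⁅ a ⁆ ∪ (S - v)

∣⁅x⁆∪p∣≤1+∣p∣ : ∀ (x : Fin n) p → ∣ ⁅ x ⁆ ∪ p ∣ ≤ suc ∣ p ∣
∣⁅x⁆∪p∣≤1+∣p∣ x p = subst (λ c → ∣ ⁅ x ⁆ ∪ p ∣ ≤ c + ∣ p ∣) (∣⁅x⁆∣≡1 x) (∣p∪q∣≤∣p∣+∣q∣ ⁅ x ⁆ p)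

module _ {n : ℕ} (G : Graph n) where
  open Graph G using (Adj; adj?; irrefl) renaming (sym to Adj-sym)

  private
    variable
      a s u v w : Fin n
      S T X Y Z : Subset n

    N⟨_⟩ : Fin n → Subset n
    N⟨_⟩ = N[_] G

    N : Subset n → Subset n
    N = N⟦_⟧ G

  -- Neighbourhoods

  v∈N[v] : v ∈ N⟨ v ⟩
  v∈N[v] {v} = x∈p∪q⁺ (inj₁ (x∈⁅x⁆ v))

  Adj⇒∈N[] : Adj v u → u ∈ N⟨ v ⟩
  Adj⇒∈N[] {v} vu = x∈p∪q⁺ (inj₂ (∈⟪⟫⁺ (adj? v) vu))

  ∈N[]-sym : u ∈ N⟨ v ⟩ → v ∈ N⟨ u ⟩
  ∈N[]-sym {u} {v} u∈ with x∈p∪q⁻ ⁅ v ⁆ (openNbhd G v) u∈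
  ... | inj₂ u∈open = Adj⇒∈N[] (Adj-sym (∈⟪⟫⁻ (adj? v) u∈open))
  ... | inj₁ u∈⁅v⁆ with x∈⁅y⁆⇒x≡y v u∈⁅v⁆
  ...   | refl = v∈N[v]

  degree<∣N[]∣ : ∀ v → degree G v < ∣ N⟨ v ⟩ ∣
  degree<∣N[]∣ v = subst (λ c → c + degree G v ≤ ∣ N⟨ v ⟩ ∣) (∣⁅x⁆∣≡1 v)
    (disjoint⇒∣p∣+∣q∣≤∣r∣ (p⊆p∪q (openNbhd G v)) (q⊆p∪q ⁅ v ⁆ (openNbhd G v))
      (λ x∈ x∈open → irrefl (sym (x∈⁅y⁆⇒x≡y v x∈)) (∈⟪⟫⁻ (adj? v) x∈open)))

  N⟦_⟧? : ∀ S → Decidable (λ u → ∃ λ s → s ∈ S × u ∈ N⟨ s ⟩)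
  N⟦ S ⟧? u = any? (λ s → (s ∈? S) ×-dec (u ∈? N⟨ s ⟩))

  ∈N⟦⟧⁺ : s ∈ S → x ∈ N⟨ s ⟩ → x ∈ N S
  ∈N⟦⟧⁺ {s} {S} s∈S x∈ = ∈⟪⟫⁺ N⟦ S ⟧? (s , s∈S , x∈)

  ∈N⟦⟧⁻ : x ∈ N S → ∃ λ s → s ∈ S × x ∈ N⟨ s ⟩
  ∈N⟦⟧⁻ {S = S} = ∈⟪⟫⁻ N⟦ S ⟧?

  N⟦⟧-mono : S ⊆ T → N S ⊆ N T
  N⟦⟧-mono S⊆T x∈ with s , s∈S , x∈N[s] ← ∈N⟦⟧⁻ x∈ = ∈N⟦⟧⁺ (S⊆T s∈S) x∈N[s]

  S⊆N⟦S⟧ : S ⊆ N S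
  S⊆N⟦S⟧ s∈S = ∈N⟦⟧⁺ s∈S v∈N[v]

  -- Propagation

  -- One round of the propagation rule for an arbitrary set, so that monotonicity and closedness can
  -- be expressed; `P S (suc (suc i))` unfolds to `step (P S (suc i))`.
  step : Subset n → Subset n
  step X = X ∪ N (propagators G X)

  X⊆stepX : X ⊆ step X
  X⊆stepX {X} = p⊆p∪q (N (propagators G X))

  propagator? : ∀ X → Decidable (λ v → v ∈ X × ∣ N⟨ v ⟩ ─ X ∣ ≤ 1)
  propagator? X v = (v ∈? X) ×-dec (∣ N⟨ v ⟩ ─ X ∣ ≤? 1)

  force : ∀ Z → v ∈ X → N⟨ v ⟩ ─ X ⊆ Z → ∣ Z ∣ ≤ 1 → N⟨ v ⟩ ⊆ step X
  force {v} {X} Z v∈X rest⊆Z ∣Z∣≤1 x∈ = x∈p∪q⁺ (inj₂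
    (∈N⟦⟧⁺ (∈⟪⟫⁺ (propagator? X) (v∈X , ≤-trans (p⊆q⇒∣p∣≤∣q∣ rest⊆Z) ∣Z∣≤1)) x∈))

  ∈propagators⁻ : v ∈ propagators G X → v ∈ X × ∣ N⟨ v ⟩ ─ X ∣ ≤ 1
  ∈propagators⁻ {X = X} = ∈⟪⟫⁻ (propagator? X)

  step-mono : X ⊆ Y → step X ⊆ step Y
  step-mono {X} {Y} X⊆Y x∈ with x∈p∪q⁻ X _ x∈
  ... | inj₁ x∈X = X⊆stepX (X⊆Y x∈X)
  ... | inj₂ x∈N with v , v∈prop , x∈N[v] ← ∈N⟦⟧⁻ x∈N
                 with v∈X , ∣rest∣≤1 ← ∈propagators⁻ v∈prop =
    force (N⟨ v ⟩ ─ X) (X⊆Y v∈X)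
      (λ y∈ → x∈p∧x∉q⇒x∈p─q (p─q⊆p _ Y y∈) (x∈p─q⇒x∉q _ Y y∈ ∘ X⊆Y))
      ∣rest∣≤1 x∈N[v]

  P-mono : N S ⊆ step (N T) → ∀ i → P G S (suc i) ⊆ P G T (suc (suc i))
  P-mono S⊆T zero    = S⊆T
  P-mono S⊆T (suc i) = step-mono (P-mono S⊆T i)

  -- Once `T` has caught up with `N S` in one extra round, monotonicity keeps it at most one round
  -- behind `S` forever.
  IsPDS-transfer : N S ⊆ step (N T) → IsPDS G S → IsPDS G T
  IsPDS-transfer S⊆T (suc i , _ , PS≡⊤) =
    suc (suc i) , s≤s z≤n , ⊆-antisym ⊆⊤ (λ {x} x∈ → P-mono S⊆T i (subst (x ∈_) (sym PS≡⊤) x∈))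

  closed⇒P⊆ : N S ⊆ X → step X ⊆ X → ∀ i → P G S (suc i) ⊆ X
  closed⇒P⊆ N⊆X closed zero    = N⊆X
  closed⇒P⊆ N⊆X closed (suc i) = closed ∘ step-mono (closed⇒P⊆ N⊆X closed i)

  N⊆P : ∀ S i → N S ⊆ P G S (suc i)
  N⊆P S zero    = id
  N⊆P S (suc i) = X⊆stepX ∘ N⊆P S i

  -- A round that adds nothing leaves a set closed under propagation; such a set contains every
  -- `P S (suc j)`, one of which is `⊤`. So each round before completion adds a vertex.
  P-growth : IsPDS G S → ∀ i → P G S (suc i) ≡ ⊤ ⊎ ∣ N S ∣ + i ≤ ∣ P G S (suc i) ∣
  P-growth {S} pds zero = inj₂ (≤-reflexive (+-identityʳ ∣ N S ∣))
  P-growth {S} pds@(suc j , _ , PS≡⊤) (suc i) with P-growth pds i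
  ... | inj₁ full = inj₁ (⊆-antisym ⊆⊤ (λ {x} x∈ → X⊆stepX (subst (x ∈_) (sym full) x∈)))
  ... | inj₂ large with P G S (suc i) ⊂? step (P G S (suc i))
  ...   | yes grows = inj₂ (subst (_≤ ∣ P G S (suc (suc i)) ∣) (sym (+-suc ∣ N S ∣ i))
            (≤-trans (s≤s large) (p⊂q⇒∣p∣<∣q∣ grows)))
  ...   | no ¬grows = inj₁ (⊆-antisym ⊆⊤ (λ {x} x∈ →
            X⊆stepX (closed⇒P⊆ (N⊆P S i) closed j (subst (x ∈_) (sym PS≡⊤) x∈))))
    where
    closed : step (P G S (suc i)) ⊆ P G S (suc i)
    closed {x} x∈ = decidable-stable (x ∈? P G S (suc i)) (λ x∉ → ¬grows (X⊆stepX , x , x∈ , x∉))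

  radius-bound : IsPDS G S → ∃ λ r → IsRadius G S r × r + ∣ N S ∣ ≤ suc n
  radius-bound {S} pds =
    let r , isRadius , r≤ = least covers? covered in
    r , isRadius , ≤-trans (+-monoˡ-≤ ∣ N S ∣ r≤) (s≤s (≤-reflexive (m∸n+n≡m (∣p∣≤n (N S)))))
    where
    covers? : Decidable (CoversAt G S)
    covers? i = (1 ≤? i) ×-dec Vec.≡-dec Bool._≟_ (P G S i) ⊤

    -- After this many rounds beyond the first, the growth bound reaches `n`.
    i : ℕ
    i = n ∸ ∣ N S ∣

    covered : CoversAt G S (suc i)
    covered with P-growth pds i
    ... | inj₁ full  = s≤s z≤n , full
    ... | inj₂ large = s≤s z≤n , ∣p∣≡n⇒p≡⊤ (≤-antisym (∣p∣≤n (P G S (suc i)))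
            (subst (_≤ ∣ P G S (suc i) ∣) (m+[n∸m]≡n (∣p∣≤n (N S))) large))

  -- External private neighbours

  -- Removing `v` itself makes these neighbours external even when `v` has no neighbour in `S`; see
  -- `epn∩S≡∅`.
  epn : Subset n → Fin n → Subset n
  epn S v = N⟨ v ⟩ ─ N (S - v) - v

  ∈epn⁻ : x ∈ epn S v → x ∈ N⟨ v ⟩ × x ∉ N (S - v) × x ≢ v
  ∈epn⁻ {x} {S} {v} x∈ with x∈′ , x≢v ← x∈p-y⁻ (N⟨ v ⟩ ─ N (S - v)) v x∈ =
    p─q⊆p _ (N (S - v)) x∈′ , x∈p─q⇒x∉q N⟨ v ⟩ _ x∈′ , x≢v

  ∈epn⁺ : x ∈ N⟨ v ⟩ → x ∉ N (S - v) → x ≢ v → x ∈ epn S v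
  ∈epn⁺ x∈ x∉ x≢v = x∈p∧x≢y⇒x∈p-y (x∈p∧x∉q⇒x∈p─q x∈ x∉) x≢v

  epn⊆N⟦⟧ : v ∈ S → epn S v ⊆ N S
  epn⊆N⟦⟧ v∈S x∈ = ∈N⟦⟧⁺ v∈S (proj₁ (∈epn⁻ x∈))

  epn-unique : x ∈ epn S v → s ∈ S → x ∈ N⟨ s ⟩ → s ≡ v
  epn-unique {x} {S} {v} {s} x∈ s∈S x∈N[s] with s ≟ v
  ... | yes s≡v = s≡v
  ... | no  s≢v = contradiction (∈N⟦⟧⁺ (x∈p∧x≢y⇒x∈p-y s∈S s≢v) x∈N[s]) (proj₁ (proj₂ (∈epn⁻ x∈)))

  epn-disjoint : u ∈ S → x ∈ epn S u → x ∈ epn S v → u ≡ v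
  epn-disjoint u∈S x∈u x∈v = epn-unique x∈v u∈S (proj₁ (∈epn⁻ x∈u))

  epn∩S≡∅ : x ∈ epn S v → x ∉ S
  epn∩S≡∅ x∈ x∈S = proj₂ (proj₂ (∈epn⁻ x∈)) (epn-unique x∈ x∈S v∈N[v])

  N⟦⟧-split : x ∈ N S → ∀ v → x ∈ N (S - v) ⊎ x ∈ N⟨ v ⟩
  N⟦⟧-split {x} {S} x∈ v with s , s∈S , x∈N[s] ← ∈N⟦⟧⁻ x∈ with s ≟ v
  ... | yes refl = inj₂ x∈N[s]
  ... | no  s≢v  = inj₁ (∈N⟦⟧⁺ (x∈p∧x≢y⇒x∈p-y s∈S s≢v) x∈N[s])

  -- Only private neighbours of `v` can be missing from `N T`. If at most one is, `v` forces it, and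
  -- `N S` is covered one round late.
  IsPDS-shift : ∀ Z → N (S - v) ⊆ N T → v ∈ N T → epn S v ─ N T ⊆ Z → ∣ Z ∣ ≤ 1 → IsPDS G S → IsPDS G T
  IsPDS-shift {S} {v} {T} Z N⊆ v∈ rest⊆Z ∣Z∣≤1 = IsPDS-transfer covered
    where
    rest : N⟨ v ⟩ ─ N T ⊆ Z
    rest x∈ = rest⊆Z (x∈p∧x∉q⇒x∈p─q
      (∈epn⁺ (p─q⊆p _ (N T) x∈) (x∉NT ∘ N⊆) (λ { refl → x∉NT v∈ })) x∉NT)
      where x∉NT = x∈p─q⇒x∉q N⟨ v ⟩ (N T) x∈

    covered : N S ⊆ step (N T)
    covered x∈ with N⟦⟧-split x∈ v
    ... | inj₁ x∈N    = X⊆stepX (N⊆ x∈N)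
    ... | inj₂ x∈N[v] = force Z v∈ rest ∣Z∣≤1 x∈N[v]

  N⟦S-v⟧⊆N⟦exchange⟧ : N (S - v) ⊆ N (exchange S v a)
  N⟦S-v⟧⊆N⟦exchange⟧ {S} {v} {a} = N⟦⟧-mono (q⊆p∪q ⁅ a ⁆ (S - v))

  N[a]⊆N⟦exchange⟧ : N⟨ a ⟩ ⊆ N (exchange S v a)
  N[a]⊆N⟦exchange⟧ {a} = ∈N⟦⟧⁺ (x∈p∪q⁺ (inj₁ (x∈⁅x⁆ a)))

  ∣exchange∣≤ : v ∈ S → ∣ exchange S v a ∣ ≤ ∣ S ∣
  ∣exchange∣≤ {v} {S} {a} v∈S = ≤-trans (∣⁅x⁆∪p∣≤1+∣p∣ a (S - v)) (x∈p⇒∣p-x∣<∣p∣ v∈S)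

  isolated? : ∀ S → Decidable (λ v → v ∈ S × v ∉ N (S - v))
  isolated? S v = (v ∈? S) ×-dec ¬? (v ∈? N (S - v))

  isolated : Subset n → Subset n
  isolated S = ⟪ isolated? S ⟫

  -- Minimum power dominating sets with private pairs

  module _ {δ : ℕ} (δ≤degree : ∀ v → δ ≤ degree G v)
           {γ : ℕ} (γ≤ : ∀ {T} → IsPDS G T → γ ≤ ∣ T ∣) where

    IsMinimumPDS : Pred (Subset n) 0ℓ
    IsMinimumPDS S = IsPDS G S × ∣ S ∣ ≡ γ

    HasPrivatePairs : Pred (Subset n) 0ℓ
    HasPrivatePairs S = ∀ {v} → v ∈ S → 2 ≤ ∣ epn S v ∣

    exchange-minimum : v ∈ S → ∣ S ∣ ≡ γ → IsPDS G (exchange S v a) → IsMinimumPDS (exchange S v a)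
    exchange-minimum {v} {S} {a} v∈S ∣S∣≡γ pds =
      pds , ≤-antisym (subst (∣ exchange S v a ∣ ≤_) ∣S∣≡γ (∣exchange∣≤ {a = a} v∈S)) (γ≤ pds)

    δ<∣N[]∣ : ∀ v → δ < ∣ N⟨ v ⟩ ∣
    δ<∣N[]∣ v = ≤-<-trans (δ≤degree v) (degree<∣N[]∣ v)

    -- Turns every lower bound on the closed neighbourhood of a minimum set into an upper bound on
    -- the propagation radius.
    rad+≤1+n : ∀ {rad c} → IsPropagationRadius G rad → IsMinimumPDS S → c ≤ ∣ N S ∣ → rad + c ≤ suc n
    rad+≤1+n {S} {rad} (_ , rad-min) (pds , ∣S∣≡γ) c≤ with r , isRadius , bound ← radius-bound pds =
      ≤-trans (+-mono-≤ (rad-min r (S , pds , isPDN , isRadius)) c≤) bound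
      where
      isPDN : IsPowerDominationNumber G ∣ S ∣
      isPDN = (S , pds , refl) , λ { k (T , pdsT , refl) → subst (_≤ ∣ T ∣) (sym ∣S∣≡γ) (γ≤ pdsT) }

    -- A vertex of S with at most one private neighbour has no neighbour in S, by
    -- minimality; trading it for a neighbour which is not private leaves fewer
    -- isolated vertices in the subgraph induced by S.
    decrease-isolated : 2 ≤ δ → IsMinimumPDS S → v ∈ S → ∣ epn S v ∣ ≤ 1 →
      ∃ λ T → IsMinimumPDS T × ∣ isolated T ∣ < ∣ isolated S ∣
    decrease-isolated {S} {v} 2≤δ (pds , ∣S∣≡γ) v∈S ∣epn∣≤1 with v ∈? N (S - v)
    -- Here `v` is dominated by the rest of `S` and forces its only possible private neighbour, so
    -- `S - v` would already be power dominating.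
    ... | yes v∈ = contradiction
      (γ≤ (IsPDS-shift {T = S - v} (epn S v) id v∈ (p─q⊆p _ (N (S - v))) ∣epn∣≤1 pds))
      (<⇒≱ (subst (∣ S - v ∣ <_) ∣S∣≡γ (x∈p⇒∣p-x∣<∣p∣ v∈S)))
    ... | no v∉
      with u , u∈open , u∉epn ← ∣q∣<∣p∣⇒∃∈p∉q (openNbhd G v) (epn S v)
             (<-≤-trans (s≤s ∣epn∣≤1) (≤-trans 2≤δ (δ≤degree v))) =
      exchange S v u , exchange-minimum v∈S ∣S∣≡γ pds′ ,
      ≤-<-trans (p⊆q⇒∣p∣≤∣q∣ shrinks) (x∈p⇒∣p-x∣<∣p∣ (∈⟪⟫⁺ (isolated? S) (v∈S , v∉)))
      where
      vu : Adj v u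
      vu = ∈⟪⟫⁻ (adj? v) u∈open

      u≢v : u ≢ v
      u≢v refl = irrefl refl vu

      u∈N⟦S-v⟧ : u ∈ N (S - v)
      u∈N⟦S-v⟧ = decidable-stable (u ∈? N (S - v)) (λ u∉ → u∉epn (∈epn⁺ (Adj⇒∈N[] vu) u∉ u≢v))

      v∈N[u] : v ∈ N⟨ u ⟩
      v∈N[u] = Adj⇒∈N[] (Adj-sym vu)

      u∉S : u ∉ S
      u∉S u∈S = v∉ (∈N⟦⟧⁺ (x∈p∧x≢y⇒x∈p-y u∈S u≢v) v∈N[u])

      pds′ : IsPDS G (exchange S v u)
      pds′ = IsPDS-shift (epn S v) N⟦S-v⟧⊆N⟦exchange⟧ (N[a]⊆N⟦exchange⟧ {S = S} v∈N[u])
        (p─q⊆p _ (N (exchange S v u))) ∣epn∣≤1 pds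

      ∈exchange-⁺ : s ∈ S → s ≢ v → s ≢ x → s ∈ exchange S v u - x
      ∈exchange-⁺ s∈S s≢v s≢x =
        x∈p∧x≢y⇒x∈p-y (x∈p∪q⁺ (inj₂ (x∈p∧x≢y⇒x∈p-y s∈S s≢v))) s≢x

      shrinks : isolated (exchange S v u) ⊆ isolated S - v
      shrinks {x} x∈ with x∈T , x∉N ← ∈⟪⟫⁻ (isolated? (exchange S v u)) x∈
                     with x∈p∪q⁻ ⁅ u ⁆ (S - v) x∈T
      -- The new vertex `u` is not isolated: not being private, it has a neighbour in `S - v`.
      ... | inj₁ x∈⁅u⁆ with refl ← x∈⁅y⁆⇒x≡y u x∈⁅u⁆
                       with s , s∈S-v , u∈N[s] ← ∈N⟦⟧⁻ u∈N⟦S-v⟧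
                       with s∈S , s≢v ← x∈p-y⁻ S v s∈S-v =
        contradiction (∈N⟦⟧⁺ (∈exchange-⁺ s∈S s≢v (λ { refl → u∉S s∈S })) u∈N[s]) x∉N
      ... | inj₂ x∈S-v with x∈S , x≢v ← x∈p-y⁻ S v x∈S-v =
        x∈p∧x≢y⇒x∈p-y (∈⟪⟫⁺ (isolated? S) (x∈S , still-isolated)) x≢v
        where
        still-isolated : x ∉ N (S - x)
        still-isolated x∈N with s , s∈S-x , x∈N[s] ← ∈N⟦⟧⁻ x∈N
                           with s∈S , s≢x ← x∈p-y⁻ S x s∈S-x
                           with s ≟ v
        -- A neighbour `x` of `v` in `S` would contradict that `v` is isolated.
        ... | yes refl = v∉ (∈N⟦⟧⁺ x∈S-v (∈N[]-sym x∈N[s]))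
        ... | no  s≢v  = x∉N (∈N⟦⟧⁺ (∈exchange-⁺ s∈S s≢v s≢x) x∈N[s])

    private-pairs : 2 ≤ δ → IsMinimumPDS S → ∃ λ T → IsMinimumPDS T × HasPrivatePairs T
    private-pairs 2≤δ min = go min (<-wellFounded _)
      where
      go : IsMinimumPDS S → Acc _<_ ∣ isolated S ∣ → ∃ λ T → IsMinimumPDS T × HasPrivatePairs T
      go {S} min (acc rec) with any? (λ v → (v ∈? S) ×-dec (∣ epn S v ∣ ≤? 1))
      ... | no  none = S , min , λ {v} v∈S → ≰⇒> (λ small → none (v , v∈S , small))
      ... | yes (v , v∈S , small) with T , minT , fewer ← decrease-isolated 2≤δ min v∈S small =
        go minT (rec fewer)

    -- Lower bounds on the closed neighbourhood

    module _ {S : Subset n} (min : IsMinimumPDS S) (pairs : HasPrivatePairs S) where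

      private
        pds : IsPDS G S
        pds = proj₁ min

        ∣S∣≡γ : ∣ S ∣ ≡ γ
        ∣S∣≡γ = proj₂ min

        γ≤∣S-v∣+1 : ∀ v → γ ≤ ∣ S - v ∣ + 1
        γ≤∣S-v∣+1 v = subst (_≤ ∣ S - v ∣ + 1) ∣S∣≡γ (∣p∣≤∣p-x∣+1 S v)

        ∈S-⁻ : u ∈ S - v → u ∈ S × u ≢ v
        ∈S-⁻ {v = v} = x∈p-y⁻ S v

      3γ≤∣N⟦S⟧∣ : 3 * γ ≤ ∣ N S ∣
      3γ≤∣N⟦S⟧∣ = begin
        3 * γ               ≡⟨ triple γ ⟩
        γ * 2 + γ           ≡⟨ cong₂ (λ a b → a * 2 + b) (sym ∣S∣≡γ) (sym ∣S∣≡γ) ⟩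
        ∣ S ∣ * 2 + ∣ S ∣   ≤⟨ +-monoˡ-≤ ∣ S ∣ (packing S (epn S) (N S ─ S) pairs
                                 (λ u∈S x∈ → x∈p∧x∉q⇒x∈p─q (epn⊆N⟦⟧ u∈S x∈) (epn∩S≡∅ x∈))
                                 (λ u∈S _ → epn-disjoint u∈S)) ⟩
        ∣ N S ─ S ∣ + ∣ S ∣ ≤⟨ q⊆p⇒∣p─q∣+∣q∣≤∣p∣ S⊆N⟦S⟧ ⟩
        ∣ N S ∣             ∎
        where
        open ≤-Reasoning
        triple : ∀ g → 3 * g ≡ g * 2 + g
        triple = solve-∀

      private
        N[]⊆N⟦S⟧ : w ∈ S → N⟨ w ⟩ ⊆ N S
        N[]⊆N⟦S⟧ w∈S = ∈N⟦⟧⁺ w∈S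

        epn⊆N⟦S⟧─N[] : w ∈ S → u ∈ S - w → epn S u ⊆ N S ─ N⟨ w ⟩
        epn⊆N⟦S⟧─N[] {w} w∈S u∈ x∈ with u∈S , u≢w ← ∈S-⁻ u∈ =
          x∈p∧x∉q⇒x∈p─q (epn⊆N⟦⟧ u∈S x∈) (λ x∈N[w] → u≢w (sym (epn-unique x∈ w∈S x∈N[w])))

        -- Used with `c` the size of `S - w` and `M` the part of `N S` outside `N⟨ w ⟩`. The slack
        -- `d` is 0 for the plain bound and 1 when a further vertex of `M` is left over.
        count : ∀ c d (M : Subset n) → γ ≤ c + 1 → c * 2 + d ≤ ∣ M ∣ → ∣ M ∣ + suc δ ≤ ∣ N S ∣ →
                2 * γ + δ + d ≤ suc ∣ N S ∣
        count c d M γ≤c+1 c≤ M≤ = begin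
          2 * γ + δ + d              ≤⟨ +-monoˡ-≤ d (+-monoˡ-≤ δ (*-monoʳ-≤ 2 γ≤c+1)) ⟩
          2 * (c + 1) + δ + d        ≡⟨ rearrange c d δ ⟩
          suc (c * 2 + d + suc δ)    ≤⟨ s≤s (+-monoˡ-≤ (suc δ) c≤) ⟩
          suc (∣ M ∣ + suc δ)        ≤⟨ s≤s M≤ ⟩
          suc ∣ N S ∣                ∎
          where
          open ≤-Reasoning
          rearrange : ∀ c d e → 2 * (c + 1) + e + d ≡ suc (c * 2 + d + suc e)
          rearrange = solve-∀

        outside-N[] : w ∈ S → ∣ N S ─ N⟨ w ⟩ ∣ + suc δ ≤ ∣ N S ∣
        outside-N[] {w} w∈S = ≤-trans (+-monoʳ-≤ _ (δ<∣N[]∣ w)) (q⊆p⇒∣p─q∣+∣q∣≤∣p∣ (N[]⊆N⟦S⟧ w∈S))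

      -- The private pairs of the other γ - 1 vertices avoid `N⟨ w ⟩`, which has at least δ + 1
      -- elements.
      2γ+δ≤1+∣N⟦S⟧∣ : w ∈ S → 2 * γ + δ ≤ suc ∣ N S ∣
      2γ+δ≤1+∣N⟦S⟧∣ {w} w∈S = subst (_≤ suc ∣ N S ∣) (+-identityʳ (2 * γ + δ))
        (count (∣ S - w ∣) 0 (N S ─ N⟨ w ⟩) (γ≤∣S-v∣+1 w)
          (≤-trans (≤-reflexive (+-identityʳ (∣ S - w ∣ * 2))) packed)
          (outside-N[] w∈S))
        where
        packed : ∣ S - w ∣ * 2 ≤ ∣ N S ─ N⟨ w ⟩ ∣
        packed = packing (S - w) (epn S) (N S ─ N⟨ w ⟩)
          (pairs ∘ proj₁ ∘ ∈S-⁻)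
          (epn⊆N⟦S⟧─N[] w∈S)
          (λ u∈ _ → epn-disjoint (proj₁ (∈S-⁻ u∈)))

      -- The case of equality

      module _ (tight : ∣ N S ∣ < 2 * γ + δ) where

        -- Equality in the count behind 2γ+δ≤1+∣N⟦S⟧∣: beyond N[w] there are only the
        -- private neighbours of the other vertices of S, two for each.
        tight-private : w ∈ S → x ∈ N S → x ∉ N⟨ w ⟩ →
          ∃ λ u → u ∈ S × x ∈ epn S u × ∣ epn S u - x ∣ ≤ 1
        tight-private {w} {x} w∈S x∈ x∉N[w]
          with any? (λ u → (u ∈? (S - w)) ×-dec (∣ epn S u - x ∣ ≤? 1))
        ... | yes (u , u∈ , small) = u , u∈S , x∈epn , small
          where
          u∈S = proj₁ (∈S-⁻ u∈)
          x∈epn : x ∈ epn S u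
          x∈epn = decidable-stable (x ∈? epn S u) (λ x∉ → <⇒≱ (pairs u∈S)
            (≤-trans (p⊆q⇒∣p∣≤∣q∣ {p = epn S u} {epn S u - x} (λ y∈ → x∈p∧x≢y⇒x∈p-y y∈ (λ { refl → x∉ y∈ }))) small))
        -- Now every `epn S u - x` still has two elements, so `x` is one vertex too many in the
        -- count.
        ... | no none = contradiction
          (count (∣ S - w ∣) 1 (N S ─ N⟨ w ⟩) (γ≤∣S-v∣+1 w) packed (outside-N[] w∈S))
          (<⇒≱ (subst (suc ∣ N S ∣ <_) (+-comm 1 (2 * γ + δ)) (s≤s tight)))
          where
          packed : ∣ S - w ∣ * 2 + 1 ≤ ∣ N S ─ N⟨ w ⟩ ∣
          packed = ≤-trans (+-monoˡ-≤ 1 (packing (S - w) (λ u → epn S u - x) (N S ─ N⟨ w ⟩ - x)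
              (λ {u} u∈ → ≰⇒> (λ small → none (u , u∈ , small)))
              (λ {u} u∈ y∈ → let y∈epn , y≢x = x∈p-y⁻ (epn S u) x y∈ in
                x∈p∧x≢y⇒x∈p-y (epn⊆N⟦S⟧─N[] w∈S u∈ y∈epn) y≢x)
              (λ {u} {v} u∈ _ y∈u y∈v → epn-disjoint (proj₁ (∈S-⁻ u∈))
                (proj₁ (x∈p-y⁻ (epn S u) x y∈u)) (proj₁ (x∈p-y⁻ (epn S v) x y∈v)))))
            (subst (_≤ ∣ N S ─ N⟨ w ⟩ ∣) (+-comm 1 _) (x∈p⇒∣p-x∣<∣p∣ (x∈p∧x∉q⇒x∈p─q x∈ x∉N[w])))

        -- As `a` lies outside `N⟨ w ⟩`, `tight-private` applies to it, and disjointness identifies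
        -- the vertex found with `v`. Together with `pairs`, `v` has exactly two private neighbours.
        tight-epn : w ∈ S → w ≢ v → v ∈ S → a ∈ epn S v → ∣ epn S v - a ∣ ≤ 1
        tight-epn {w} {v} {a} w∈S w≢v v∈S a∈
          with u , u∈S , a∈′ , small ← tight-private w∈S (epn⊆N⟦⟧ v∈S a∈) (w≢v ∘ epn-unique a∈ w∈S)
          with refl ← epn-disjoint u∈S a∈′ a∈ = small

        -- After the exchange, `a` dominates `v`, which forces its other private neighbour. That
        -- neighbour is the only vertex of `N S` that can be lost, while `a` contributes at least
        -- two new ones.
        exchange-enlarges : w ∈ S → w ≢ v → v ∈ S → a ∈ epn S v → 2 ≤ ∣ N⟨ a ⟩ ─ N S ∣ →
          ∃ λ T → IsMinimumPDS T × ∣ N S ∣ < ∣ N T ∣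
        exchange-enlarges {w} {v} {a} w∈S w≢v v∈S a∈ new =
          exchange S v a , exchange-minimum v∈S ∣S∣≡γ pds′ , larger
          where
          S′ = exchange S v a

          ∣epn-a∣≤1 : ∣ epn S v - a ∣ ≤ 1
          ∣epn-a∣≤1 = tight-epn w∈S w≢v v∈S a∈

          N[a]⊆ : N⟨ a ⟩ ⊆ N S′
          N[a]⊆ = N[a]⊆N⟦exchange⟧ {S = S}

          v∈NS′ : v ∈ N S′
          v∈NS′ = N[a]⊆ (∈N[]-sym (proj₁ (∈epn⁻ a∈)))

          pds′ : IsPDS G S′
          pds′ = IsPDS-shift (epn S v - a) N⟦S-v⟧⊆N⟦exchange⟧ v∈NS′
            (λ y∈ → x∈p∧x≢y⇒x∈p-y (p─q⊆p _ (N S′) y∈) (λ { refl → x∈p─q⇒x∉q (epn S v) (N S′) y∈ (N[a]⊆ v∈N[v]) }))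
            ∣epn-a∣≤1 pds

          kept : N S ⊆ (N S ∩ N S′) ∪ (epn S v - a)
          kept {x} x∈ with x ∈? N S′
          ... | yes x∈NS′ = x∈p∪q⁺ (inj₁ (x∈p∩q⁺ (x∈ , x∈NS′)))
          ... | no  x∉NS′ with N⟦⟧-split x∈ v
          ...   | inj₁ x∈N = contradiction (N⟦S-v⟧⊆N⟦exchange⟧ x∈N) x∉NS′
          ...   | inj₂ x∈N[v] = x∈p∪q⁺ (inj₂ (x∈p∧x≢y⇒x∈p-y
                  (∈epn⁺ x∈N[v] (x∉NS′ ∘ N⟦S-v⟧⊆N⟦exchange⟧) (λ { refl → x∉NS′ v∈NS′ }))
                  (λ { refl → x∉NS′ (N[a]⊆ v∈N[v]) })))

          larger : ∣ N S ∣ < ∣ N S′ ∣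
          larger = begin-strict
            ∣ N S ∣                               ≤⟨ p⊆q∪r⇒∣p∣≤∣q∣+∣r∣ kept ⟩
            ∣ N S ∩ N S′ ∣ + ∣ epn S v - a ∣       <⟨ +-monoʳ-< ∣ N S ∩ N S′ ∣ (<-≤-trans (s≤s ∣epn-a∣≤1) new) ⟩
            ∣ N S ∩ N S′ ∣ + ∣ N⟨ a ⟩ ─ N S ∣      ≤⟨ disjoint⇒∣p∣+∣q∣≤∣r∣ (p∩q⊆q (N S) (N S′))
                                                       (N[a]⊆ ∘ p─q⊆p _ (N S))
                                                       (λ y∈ y∈′ → x∈p─q⇒x∉q N⟨ a ⟩ (N S) y∈′ (p∩q⊆p (N S) (N S′) y∈)) ⟩
            ∣ N S′ ∣                               ∎
            where open ≤-Reasoning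

        -- Otherwise `N⟨ a ⟩` misses `S - v` and all private neighbours of its members, at least 3(γ
        -- - 1) vertices of `N S`, and itself meets `N S` in at least δ vertices. For γ > 2 the
        -- total is at least 2γ + δ, against tightness.
        adjacent-private : 2 < γ → v ∈ S → a ∈ epn S v → ∣ N⟨ a ⟩ ─ N S ∣ ≤ 1 →
          ∃ λ u → ∃ λ b → u ∈ S × u ≢ v × b ∈ epn S u × b ∈ N⟨ a ⟩
        adjacent-private {v} {a} 2<γ v∈S a∈ few
          with any? (λ u → any? (λ b → (u ∈? (S - v)) ×-dec ((b ∈? epn S u) ×-dec (b ∈? N⟨ a ⟩))))
        ... | yes (u , b , u∈ , b∈ , b∈N[a]) = u , b , proj₁ (∈S-⁻ u∈) , proj₂ (∈S-⁻ u∈) , b∈ , b∈N[a]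
        ... | no none = contradiction counted (<⇒≱ (≤-trans tight bound))
          where
          open ≤-Reasoning
          Far = N S ─ N⟨ a ⟩
          c = ∣ S - v ∣

          S-v⊆Far : S - v ⊆ Far
          S-v⊆Far s∈ with s∈S , s≢v ← ∈S-⁻ s∈ =
            x∈p∧x∉q⇒x∈p─q (S⊆N⟦S⟧ s∈S) (λ s∈N[a] → s≢v (epn-unique a∈ s∈S (∈N[]-sym s∈N[a])))

          c*2+c≤∣Far∣ : c * 2 + c ≤ ∣ Far ∣
          c*2+c≤∣Far∣ = ≤-trans
            (+-monoˡ-≤ c (packing (S - v) (epn S) (Far ─ (S - v))
              (pairs ∘ proj₁ ∘ ∈S-⁻)
              (λ {u} u∈ {x} x∈ → x∈p∧x∉q⇒x∈p─q
                (x∈p∧x∉q⇒x∈p─q (epn⊆N⟦⟧ (proj₁ (∈S-⁻ u∈)) x∈) (λ x∈N[a] → none (u , x , u∈ , x∈ , x∈N[a])))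
                (λ x∈S-v → epn∩S≡∅ x∈ (proj₁ (∈S-⁻ x∈S-v))))
              (λ u∈ _ → epn-disjoint (proj₁ (∈S-⁻ u∈)))))
            (q⊆p⇒∣p─q∣+∣q∣≤∣p∣ S-v⊆Far)

          Near = N⟨ a ⟩ ∩ N S

          near = ∣ Near ∣

          δ≤∣Near∣ : δ ≤ near
          δ≤∣Near∣ = s≤s⁻¹ (begin
            suc δ                     ≤⟨ δ<∣N[]∣ a ⟩
            ∣ N⟨ a ⟩ ∣                ≤⟨ p⊆q∪r⇒∣p∣≤∣q∣+∣r∣ cover ⟩
            near + ∣ N⟨ a ⟩ ─ N S ∣   ≤⟨ +-monoʳ-≤ near few ⟩
            near + 1                  ≡⟨ +-comm near 1 ⟩
            suc near                  ∎)
            where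
            cover : N⟨ a ⟩ ⊆ Near ∪ (N⟨ a ⟩ ─ N S)
            cover {x} x∈ with x ∈? N S
            ... | yes x∈N = x∈p∪q⁺ (inj₁ (x∈p∩q⁺ (x∈ , x∈N)))
            ... | no  x∉N = x∈p∪q⁺ (inj₂ (x∈p∧x∉q⇒x∈p─q x∈ x∉N))

          counted : c * 2 + c + δ ≤ ∣ N S ∣
          counted = ≤-trans (+-mono-≤ c*2+c≤∣Far∣ δ≤∣Near∣)
            (disjoint⇒∣p∣+∣q∣≤∣r∣ (p─q⊆p (N S) N⟨ a ⟩) (p∩q⊆q N⟨ a ⟩ (N S))
              (λ x∈ x∈′ → x∈p─q⇒x∉q (N S) N⟨ a ⟩ x∈ (p∩q⊆p N⟨ a ⟩ (N S) x∈′)))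

          2≤c : 2 ≤ c
          2≤c = s≤s⁻¹ (≤-trans 2<γ (subst (γ ≤_) (+-comm c 1) (γ≤∣S-v∣+1 v)))

          -- The assumption γ > 2 enters here: 2(c + 1) ≤ 3c needs c ≥ 2.
          bound : 2 * γ + δ ≤ c * 2 + c + δ
          bound = +-monoˡ-≤ δ (begin
            2 * γ           ≤⟨ *-monoʳ-≤ 2 (γ≤∣S-v∣+1 v) ⟩
            2 * (c + 1)     ≡⟨ double c ⟩
            c * 2 + 2       ≤⟨ +-monoʳ-≤ (c * 2) 2≤c ⟩
            c * 2 + c       ∎)
            where
            double : ∀ c → 2 * (c + 1) ≡ c * 2 + 2
            double = solve-∀

        0<∣S-v-u∣ : 2 < γ → ∀ v u → 0 < ∣ S - v - u ∣
        0<∣S-v-u∣ 2<γ v u = +-cancelʳ-< 2 0 _ (≤-trans 2<γ (≤-trans (γ≤∣S-v∣+1 v)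
          (≤-trans (+-monoˡ-≤ 1 (∣p∣≤∣p-x∣+1 (S - v) u)) (≤-reflexive (+-assoc _ 1 1)))))

        -- Suppose `a` is adjacent to a private neighbour `b` of `u`, and replace both `u` and `v`
        -- by `a`. A third vertex `w` of `S` dominates `u` and `v`, while `a` dominates one private
        -- neighbour of each; both then force the other one, so a set smaller than γ is power
        -- dominating.
        ¬adjacent-private : 2 < γ → v ∈ S → a ∈ epn S v → u ∈ S → u ≢ v →
          x ∈ epn S u → x ∉ N⟨ a ⟩
        ¬adjacent-private {v} {a} {u} {b} 2<γ v∈S a∈ u∈S u≢v b∈ b∈N[a]
          with w , w∈ ← 0<∣p∣⇒∃∈p (S - v - u) (0<∣S-v-u∣ 2<γ v u)
          with w∈S-v , w≢u ← x∈p-y⁻ (S - v) u w∈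
          with w∈S , w≢v ← ∈S-⁻ w∈S-v = <⇒≱ smaller (γ≤ pds′)
          where
          S′ = ⁅ a ⁆ ∪ (S - v - u)

          smaller : ∣ S′ ∣ < γ
          smaller = begin-strict
            ∣ S′ ∣              ≤⟨ ∣⁅x⁆∪p∣≤1+∣p∣ a (S - v - u) ⟩
            suc ∣ S - v - u ∣  ≤⟨ x∈p⇒∣p-x∣<∣p∣ (x∈p∧x≢y⇒x∈p-y u∈S u≢v) ⟩
            ∣ S - v ∣          <⟨ x∈p⇒∣p-x∣<∣p∣ v∈S ⟩
            ∣ S ∣              ≡⟨ ∣S∣≡γ ⟩
            γ                  ∎
            where open ≤-Reasoning

          N[a]⊆NS′ : N⟨ a ⟩ ⊆ N S′
          N[a]⊆NS′ = ∈N⟦⟧⁺ (x∈p∪q⁺ (inj₁ (x∈⁅x⁆ a)))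

          N[w]⊆NS′ : N⟨ w ⟩ ⊆ N S′
          N[w]⊆NS′ = ∈N⟦⟧⁺ (x∈p∪q⁺ (inj₂ w∈))

          -- By tightness everything in `N S` outside `N⟨ w ⟩` is a private neighbour, hence not in
          -- `S`.
          S⊆N[w] : S ⊆ N⟨ w ⟩
          S⊆N[w] {s} s∈S = decidable-stable (s ∈? N⟨ w ⟩) (λ s∉ →
            let _ , _ , s∈epn , _ = tight-private w∈S (S⊆N⟦S⟧ s∈S) s∉ in epn∩S≡∅ s∈epn s∈S)

          -- Generic in the pair, since it serves both `v` with `a` and `u` with `b`.
          propagates : ∀ {v a} → v ∈ S → w ≢ v → a ∈ epn S v → a ∈ N S′ → N⟨ v ⟩ ⊆ step (N S′)
          propagates {v} {a} v∈S w≢v a∈ a∈NS′ = force (epn S v - a) (N[w]⊆NS′ (S⊆N[w] v∈S)) rest (tight-epn w∈S w≢v v∈S a∈)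
            where
            rest : N⟨ v ⟩ ─ N S′ ⊆ epn S v - a
            rest {x} x∈
              with x∈N[v] ← p─q⊆p N⟨ v ⟩ (N S′) x∈
              with x∉NS′ ← x∈p─q⇒x∉q N⟨ v ⟩ (N S′) x∈
              with u , u∈S , x∈epn , _ ← tight-private w∈S (N[]⊆N⟦S⟧ v∈S x∈N[v]) (x∉NS′ ∘ N[w]⊆NS′)
              with refl ← epn-unique x∈epn v∈S x∈N[v] =
              x∈p∧x≢y⇒x∈p-y x∈epn (λ { refl → x∉NS′ a∈NS′ })

          pds′ : IsPDS G S′
          pds′ = IsPDS-transfer covered pds
            where
            covered : N S ⊆ step (N S′)
            covered {x} x∈ with x ∈? N⟨ w ⟩
            ... | yes x∈N[w] = X⊆stepX (N[w]⊆NS′ x∈N[w])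
            ... | no  x∉N[w] with s , s∈S , x∈epn , _ ← tight-private w∈S x∈ x∉N[w] with s ≟ v | s ≟ u
            ...   | yes refl | _        = propagates v∈S w≢v a∈ (N[a]⊆NS′ v∈N[v]) (proj₁ (∈epn⁻ x∈epn))
            ...   | no _     | yes refl = propagates u∈S w≢u b∈ (N[a]⊆NS′ b∈N[a]) (proj₁ (∈epn⁻ x∈epn))
            ...   | no s≢v   | no s≢u   = X⊆stepX (∈N⟦⟧⁺
                      (x∈p∪q⁺ (inj₂ (x∈p∧x≢y⇒x∈p-y (x∈p∧x≢y⇒x∈p-y s∈S s≢v) s≢u)))
                      (proj₁ (∈epn⁻ x∈epn)))

        enlarge : 2 < γ → v ∈ S → ∃ λ T → IsMinimumPDS T × ∣ N S ∣ < ∣ N T ∣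
        enlarge {v} 2<γ v∈S
          with a , a∈ ← 0<∣p∣⇒∃∈p (epn S v) (<-trans (s≤s z≤n) (pairs v∈S))
          with w , w∈ ← 0<∣p∣⇒∃∈p (S - v)
                 (+-cancelʳ-< 1 0 _ (≤-trans (<⇒≤ 2<γ) (γ≤∣S-v∣+1 v)))
          with w∈S , w≢v ← ∈S-⁻ w∈
          with 2 ≤? ∣ N⟨ a ⟩ ─ N S ∣
        ... | yes new = exchange-enlarges w∈S w≢v v∈S a∈ new
        ... | no ¬new
          with u , b , u∈S , u≢v , b∈ , b∈N[a] ← adjacent-private 2<γ v∈S a∈ (s≤s⁻¹ (≰⇒> ¬new)) =
          contradiction b∈N[a] (¬adjacent-private 2<γ v∈S a∈ u∈S u≢v b∈)

    -- Bounds on the propagation radius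

    radius-bounds : ∀ {rad} → 2 ≤ δ → 2 ≤ γ → IsMinimumPDS S → IsPropagationRadius G rad →
      rad + 3 * γ ≤ suc n × rad + (2 * γ + δ) ≤ suc (suc n) × (2 < γ → rad + (2 * γ + δ) ≤ suc n)
    radius-bounds {rad = rad} 2≤δ 2≤γ min₀ isRad
      with S , min , pairs ← private-pairs 2≤δ min₀
      with v , v∈S ← 0<∣p∣⇒∃∈p S (subst (0 <_) (sym (proj₂ min)) (<-trans (s≤s z≤n) 2≤γ)) =
      rad+≤1+n isRad min (3γ≤∣N⟦S⟧∣ min pairs) , weak , strong
      where
      almost : 2 * γ + δ ≤ suc ∣ N S ∣
      almost = 2γ+δ≤1+∣N⟦S⟧∣ min pairs v∈S

      weak : rad + (2 * γ + δ) ≤ suc (suc n)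
      weak = ≤-trans (+-monoʳ-≤ rad almost)
        (subst (_≤ suc (suc n)) (sym (+-suc rad ∣ N S ∣)) (s≤s (rad+≤1+n isRad min ≤-refl)))

      strong : 2 < γ → rad + (2 * γ + δ) ≤ suc n
      strong 2<γ with 2 * γ + δ ≤? ∣ N S ∣
      ... | yes wide = rad+≤1+n isRad min wide
      -- One enlargement suffices, because `N S` falls short of 2γ + δ by at most one vertex; `T`
      -- itself need not have private pairs.
      ... | no tight with T , minT , S<T ← enlarge min pairs (≰⇒> tight) 2<γ v∈S =
        rad+≤1+n isRad minT (≤-trans almost S<T)

-- Integer form of the bounds

i+j≤k⇒i≤k-j : ∀ i j k → i ℤ.+ j ℤ.≤ k → i ℤ.≤ k ℤ.- j
i+j≤k⇒i≤k-j i j k i+j≤k = subst (ℤ._≤ k ℤ.- j) (cancel i j) (ℤ.+-monoˡ-≤ (ℤ.- j) i+j≤k)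
  where
  cancel : ∀ i j → i ℤ.+ j ℤ.- j ≡ i
  cancel = ℤ-solve-∀

m+k≤n⇒+m≤+n-+k : ∀ m k n → m + k ≤ n → + m ℤ.≤ + n ℤ.- + k
m+k≤n⇒+m≤+n-+k m k n m+k≤n = i+j≤k⇒i≤k-j (+ m) (+ k) (+ n) (ℤ.+≤+ m+k≤n)

-- For γ = 2 the first bound gives n - 5 and the second n - δ - 2. For γ > 2 the first and third
-- combine, since γ + max(2γ, γ + δ) is the maximum of 3γ and 2γ + δ.
radius-arithmetic : ∀ {n δ γ rad} → rad + 3 * γ ≤ suc n → rad + (2 * γ + δ) ≤ suc (suc n) →
  (2 < γ → rad + (2 * γ + δ) ≤ suc n) →
  (γ ≡ 2 → δ ≡ 2 → + rad ℤ.≤ + n ℤ.- + 5) ×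
  (γ ≡ 2 → δ > 2 → + rad ℤ.≤ + n ℤ.- + δ ℤ.- + 2) ×
  (γ > 2 → + rad ℤ.≤ + n ℤ.- + γ ℤ.- + ((2 * γ) ⊔ (γ + δ)) ℤ.+ + 1)
radius-arithmetic {n} {δ} {γ} {rad} bound₁ bound₂ bound₃ =
  (λ { refl refl → m+k≤n⇒+m≤+n-+k rad 5 n (s≤s⁻¹ (subst (_≤ suc n) (+-suc rad 5) bound₁)) }) ,
  (λ { refl _ → i+j≤k⇒i≤k-j (+ rad) (+ 2) (+ n ℤ.- + δ) (m+k≤n⇒+m≤+n-+k (rad + 2) δ n
    (s≤s⁻¹ (s≤s⁻¹ (subst (_≤ suc (suc n)) (regroup rad δ) bound₂)))) }) ,
  (λ 2<γ → subst (+ rad ℤ.≤_) (shift (+ n) (+ γ) (+ M))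
    (i+j≤k⇒i≤k-j (+ rad) (+ M) (+ suc n ℤ.- + γ) (m+k≤n⇒+m≤+n-+k (rad + M) γ (suc n)
      (max-bound (2 * γ) (γ + δ)
        (subst (_≤ suc n) (regroup₁ rad γ) bound₁)
        (subst (_≤ suc n) (regroup₂ rad γ δ) (bound₃ 2<γ))))))
  where
  M = (2 * γ) ⊔ (γ + δ)

  shift : ∀ n g m → + 1 ℤ.+ n ℤ.- g ℤ.- m ≡ n ℤ.- g ℤ.- m ℤ.+ + 1
  shift = ℤ-solve-∀

  regroup : ∀ r d → r + (4 + d) ≡ suc (suc (r + 2 + d))
  regroup = solve-∀

  regroup₁ : ∀ r g → r + 3 * g ≡ r + 2 * g + g
  regroup₁ = solve-∀

  regroup₂ : ∀ r g d → r + (2 * g + d) ≡ r + (g + d) + g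
  regroup₂ = solve-∀

  max-bound : ∀ a b → rad + a + γ ≤ suc n → rad + b + γ ≤ suc n → rad + (a ⊔ b) + γ ≤ suc n
  max-bound a b a≤ b≤ with ⊔-sel a b
  ... | inj₁ eq = subst (λ c → rad + c + γ ≤ suc n) (sym eq) a≤
  ... | inj₂ eq = subst (λ c → rad + c + γ ≤ suc n) (sym eq) b≤

theorem5p2 : ∀ {n : ℕ} (G : Graph n) (δ γ rad : ℕ) →
    Connected G →
    IsMinDegree G δ → δ ≥ 2 →
    IsPowerDominationNumber G γ → γ ≥ 2 →
    IsPropagationRadius G rad →
    (γ ≡ 2 → δ ≡ 2 → + rad ℤ.≤ + n ℤ.- + 5) ×
    (γ ≡ 2 → δ > 2 → + rad ℤ.≤ + n ℤ.- + δ ℤ.- + 2) ×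
    (γ > 2 → + rad ℤ.≤ + n ℤ.- + γ ℤ.- + ((2 * γ) ⊔ (γ + δ)) ℤ.+ + 1)
theorem5p2 G δ γ rad _ (_ , δ-min) 2≤δ ((S , pds , ∣S∣≡γ) , γ-min) 2≤γ isRad =
  let bound₁ , bound₂ , bound₃ = radius-bounds G (λ v → δ-min _ (v , refl)) (λ pds → γ-min _ (_ , pds , refl))
                                   2≤δ 2≤γ (pds , ∣S∣≡γ) isRad
  in radius-arithmetic bound₁ bound₂ bound₃
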